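{- Let $t\geq 2$ be an integer. Then $b_{t+1,1}(n)\geq b_{t,1}(n)$ for all integers $n\geq 0$.
   Context: A partition of a positive integer $n$ is a finite non-increasing sequence of positive integers $\lambda=(\lambda_1,\lambda_2,\ldots,\lambda_r)$ with $\lambda_1+\cdots+\lambda_r=n$; for $n=0$ the only partition is the empty one, whose Young diagram has no boxes. The Young diagram of $\lambda$ is the left-justified array of boxes whose $i$-th row from the top has $\lambda_i$ boxes. The hook length of a box in a Young diagram is the number of boxes directly to its right (in the same row) plus the number of boxes directly below it (in the same column) plus $1$ (for the box itself). For an integer $t\geq 2$, a $t$-regular partition of $n$ is a partition of $n$ none of whose parts is divisible by $t$. For integers $t\geq 2$ and $k\geq 1$, $b_{t,k}(n)$ denotes the number of hooks of length $k$ in all the $t$-regular partitions of $n$, i.e. the sum over all $t$-regular partitions $\lambda$ of $n$ of the number of boxes in the Young diagram of $\lambda$ with hook length equal to $k$. -}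

module Defs where

open import Data.List using (List; []; _∷_; _++_; map; filter; length; upTo; concatMap; cartesianProductWith)
open import Data.List.Membership.Propositional using (_∈_; lose)
open import Data.List.Membership.Propositional.Properties
  using (∈-upTo⁺; ∈-concatMap⁺; ∈-filter⁺; ∈-filter⁻; ∈-cartesianProductWith⁺; ∈-cartesianProductWith⁻)
open import Data.List.Properties using (∷-injective)
open import Data.List.Relation.Binary.Disjoint.Propositional using (Disjoint)
open import Data.List.Relation.Unary.All as All using (All; []; _∷_)
import Data.List.Relation.Unary.All.Properties as All
open import Data.List.Relation.Unary.AllPairs as AllPairs using ()
import Data.List.Relation.Unary.AllPairs.Properties as AllPairs
open import Data.List.Relation.Unary.Any using (here)
open import Data.List.Relation.Unary.Linked as Linked using (Linked)
open import Data.List.Relation.Unary.Unique.Propositional using (Unique)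
import Data.List.Relation.Unary.Unique.Propositional.Properties as Unique
open import Data.Nat using (ℕ; zero; suc; _+_; _≤_; _<_; _≥_; z≤n; s≤s; _≟_; _≥?_; _<?_)
open import Data.Nat.Divisibility using (_∣_; _∣?_)
open import Data.Nat.ListAction using (sum)
open import Data.Nat.Properties using (≤-trans; +-mono-≤; m≤m+n; m≤n+m)
open import Data.Product using (_×_; _,_; proj₂; map₁)
open import Function using (_⇔_; mk⇔)
open import Relation.Binary.PropositionalEquality using (_≡_; _≢_; refl; sym; trans; cong)
open import Relation.Nullary using (¬_; ¬?; _×-dec_)
open import Relation.Nullary.Decidable using (map′)
open import Relation.Unary using (Decidable)

record IsPartition (n : ℕ) (λs : List ℕ) : Set where
  constructor mkIsPartition
  field
    nonincreasing : Linked _≥_ λs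
    positive      : All (0 <_) λs
    sums          : sum λs ≡ n

open IsPartition public

IsRegularPartition : (t n : ℕ) → List ℕ → Set
IsRegularPartition t n λs = IsPartition n λs × All (λ p → ¬ t ∣ p) λs

isPartition? : ∀ n → Decidable (IsPartition n)
isPartition? n λs =
  map′ (λ (d , p , s) → mkIsPartition d p s)
       (λ q → nonincreasing q , positive q , sums q)
       (Linked.linked? _≥?_ λs ×-dec All.all? (0 <?_) λs ×-dec sum λs ≟ n)

isRegularPartition? : ∀ t n → Decidable (IsRegularPartition t n)
isRegularPartition? t n λs = isPartition? n λs ×-dec All.all? (λ p → ¬? (t ∣? p)) λs

-- All lists of length r with entries in {0,…,m}.
lists : (r m : ℕ) → List (List ℕ)
lists zero    m = [] ∷ []
lists (suc r) m = cartesianProductWith _∷_ (upTo (suc m)) (lists r m)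

-- All lists of length at most n with entries in {0,…,n}.
candidates : ℕ → List (List ℕ)
candidates n = concatMap (λ r → lists r n) (upTo (suc n))

-- A partition of n has at most n parts, each at most n, so it is found among
-- the lists searched here; see ∈-regularPartitions and regularPartitions-unique.
regularPartitions : (t n : ℕ) → List (List ℕ)
regularPartitions t n = filter (isRegularPartition? t n) (candidates n)

-- A box is a pair (row , column), both counted from 0, rows from the top.
Box : Set
Box = ℕ × ℕ

youngDiagram : List ℕ → List Box
youngDiagram []       = []
youngDiagram (p ∷ ps) = map (0 ,_) (upTo p) ++ map (map₁ suc) (youngDiagram ps)

boxesRight : List ℕ → Box → List Box
boxesRight λs (i , j) = filter (λ (i′ , j′) → i′ ≟ i ×-dec j <? j′) (youngDiagram λs)

boxesBelow : List ℕ → Box → List Box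
boxesBelow λs (i , j) = filter (λ (i′ , j′) → j′ ≟ j ×-dec i <? i′) (youngDiagram λs)

hookLength : List ℕ → Box → ℕ
hookLength λs x = length (boxesRight λs x) + length (boxesBelow λs x) + 1

hookCount : (k : ℕ) → List ℕ → ℕ
hookCount k λs = length (filter (λ x → hookLength λs x ≟ k) (youngDiagram λs))

b : (t k n : ℕ) → ℕ
b t k n = sum (map (hookCount k) (regularPartitions t n))

private
  ∈-lists : ∀ {m λs} → All (_≤ m) λs → λs ∈ lists (length λs) m
  ∈-lists []       = here refl
  ∈-lists (p ∷ ps) = ∈-cartesianProductWith⁺ _∷_ (∈-upTo⁺ (s≤s p)) (∈-lists ps)

  lists-length : ∀ r m {λs} → λs ∈ lists r m → length λs ≡ r
  lists-length zero    m (here refl) = refl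
  lists-length (suc r) m i
    with _ , _ , _ , j , refl ← ∈-cartesianProductWith⁻ _∷_ (upTo (suc m)) (lists r m) i
    = cong suc (lists-length r m j)

  lists-unique : ∀ r m → Unique (lists r m)
  lists-unique zero    m = [] AllPairs.∷ AllPairs.[]
  lists-unique (suc r) m =
    Unique.cartesianProductWith⁺ _∷_ ∷-injective (Unique.upTo⁺ (suc m)) (lists-unique r m)

  parts≤sum : ∀ λs → All (_≤ sum λs) λs
  parts≤sum []       = []
  parts≤sum (p ∷ ps) =
    m≤m+n p (sum ps) ∷ All.map (λ q → ≤-trans q (m≤n+m (sum ps) p)) (parts≤sum ps)

  length≤sum : ∀ {λs} → All (0 <_) λs → length λs ≤ sum λs
  length≤sum []       = z≤n
  length≤sum (p ∷ ps) = +-mono-≤ p (length≤sum ps)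

∈-regularPartitions : ∀ t n λs → λs ∈ regularPartitions t n ⇔ IsRegularPartition t n λs
∈-regularPartitions t n λs =
  mk⇔ (λ i → proj₂ (∈-filter⁻ (isRegularPartition? t n) {xs = candidates n} i)) to∈
  where
  to∈ : IsRegularPartition t n λs → λs ∈ regularPartitions t n
  to∈ q@(mkIsPartition _ pos refl , _) =
    ∈-filter⁺ (isRegularPartition? t n)
      (∈-concatMap⁺ (λ r → lists r n)
        (lose (∈-upTo⁺ (s≤s (length≤sum pos))) (∈-lists (parts≤sum λs))))
      q

private
  lists-disjoint : ∀ {r s} n → r ≢ s → Disjoint (lists r n) (lists s n)
  lists-disjoint {r} {s} n r≢s (i , j) =
    r≢s (trans (sym (lists-length r n i)) (lists-length s n j))

  candidates-unique : ∀ n → Unique (candidates n)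
  candidates-unique n =
    Unique.concat⁺ {xss = map (λ r → lists r n) (upTo (suc n))}
      (All.map⁺ {xs = upTo (suc n)} (All.tabulate (λ {r} _ → lists-unique r n)))
      (AllPairs.map⁺ {xs = upTo (suc n)}
        (AllPairs.map (λ r≢s {_} → lists-disjoint n r≢s) (Unique.upTo⁺ (suc n))))

regularPartitions-unique : ∀ t n → Unique (regularPartitions t n)
regularPartitions-unique t n = Unique.filter⁺ (isRegularPartition? t n) (candidates-unique n)

{-# OPTIONS --safe #-}
-- A box has hook length 1 exactly when it ends the last of the rows of some
-- length, so b t 1 n counts the distinct parts of all t-regular partitions of n.
-- Removing one copy of a part m (t ∤ m) shows that m occurs in as many of them as there
-- are t-regular partitions of n - m, so with P_t the generating function of the
-- t-regular partitions, that of b t 1 is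
--
--   B_t = (q + ⋯ + q^(t-1)) / (1 - q^t) · P_t(q),
--
-- and Glaisher's identity P_t(q) = ∏_{i ≥ 1} (1 + q^i + ⋯ + q^((t-1)i)) gives
--
--   B_t = (q + ⋯ + q^(t-1)) / (1 - q) · ∏_{i ≥ 2} (1 + q^i + ⋯ + q^((t-1)i)),
--
-- whose coefficients visibly increase with t. Every series below is replaced
-- by a polynomial with the same coefficients up to q^n, acting by multiplication
-- on coefficient sequences.
module Submission where

open import Defs
open import Data.Empty using (⊥)
open import Data.List using (List; []; _∷_; _++_; _∷ʳ_; map; filter; length; upTo)
open import Data.List.Membership.Propositional using (_∈_)
open import Data.List.Membership.Propositional.Properties
  using (∈-++⁺ˡ; ∈-++⁺ʳ; ∈-++⁻; ∈-map⁺; ∈-map⁻; ∈-filter⁺; ∈-upTo⁺)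
open import Data.List.Membership.Propositional.Properties.WithK using (unique∧set⇒bag)
open import Data.List.Properties
  using (length-++; length-map; map-++; map-∘; map-cong; map-cong-local; ∷-injectiveʳ;
         filter-++; filter-≐; filter-none; filter-accept; filter-reject; upTo-∷ʳ)
open import Data.List.Relation.Binary.BagAndSetEquality using (∼bag⇒↭)
open import Data.List.Relation.Binary.Permutation.Propositional using (_↭_)
import Data.List.Relation.Binary.Permutation.Propositional.Properties as Permutation
open import Data.List.Relation.Unary.All as All using (All; []; _∷_)
import Data.List.Relation.Unary.All.Properties as All
open import Data.List.Relation.Unary.AllPairs using ([]; _∷_)
open import Data.List.Relation.Unary.Any using (here)
open import Data.List.Relation.Unary.Linked as Linked using (Linked; []; [-]; _∷_)
import Data.List.Relation.Unary.Linked.Properties as Linked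
open import Data.List.Relation.Unary.Unique.Propositional using (Unique)
import Data.List.Relation.Unary.Unique.Propositional.Properties as Unique
open import Data.Nat using (ℕ; zero; suc; _+_; _*_; _∸_; _≤_; _<_; _≥_; z≤n; s≤s; s≤s⁻¹; _≟_; _<?_)
open import Data.Nat.Divisibility using (_∣_; _∤_; _∣?_; n∣m*n; ∣m+n∣m⇒∣n; >⇒∤)
open import Data.Nat.Induction using (<-rec)
open import Data.Nat.ListAction using (sum)
open import Data.Nat.ListAction.Properties using (sum-++; sum-↭)
open import Data.Nat.Properties hiding (_≟_; _<?_)
open import Algebra.Properties.CommutativeSemigroup +-commutativeSemigroup using (interchange)
open import Data.Product using (∃-syntax; _×_; _,_; proj₁; proj₂; map₁)
open import Data.Sum using (inj₁; inj₂)
open import Function using (_∘_; id; mk⇔)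
open import Function.Bundles using (module Equivalence)
open import Relation.Binary.PropositionalEquality
open import Relation.Nullary using (Dec; yes; no; ¬_; contradiction; _×-dec_)
open import Relation.Unary using (Decidable)

private variable
  A B X : Set
  f g : ℕ → ℕ


-- Truncated geometric series acting on coefficient sequences

-- The filler `z` is a parameter so that one shift serves both coefficients, with `0`, and lists of
-- partitions, with `[]`. `shift-natural` then carries counts from the second to the first.
shift : A → ℕ → (ℕ → A) → ℕ → A
shift z zero    f n       = f n
shift z (suc m) f zero    = z
shift z (suc m) f (suc n) = shift z m f n

q^_·_ : ℕ → (ℕ → ℕ) → ℕ → ℕ
q^ m · f = shift 0 m f

infixr 9 q^_·_
infixl 6 _⊕_

_⊕_ : (ℕ → ℕ) → (ℕ → ℕ) → ℕ → ℕ
(f ⊕ g) n = f n + g n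

shift-natural : (h : A → B) (z : A) (m : ℕ) (f : ℕ → A) →
                h ∘ shift z m f ≗ shift (h z) m (h ∘ f)
shift-natural h z zero    f n       = refl
shift-natural h z (suc m) f zero    = refl
shift-natural h z (suc m) f (suc n) = shift-natural h z m f n

shift-cong-≤ : ∀ {z : A} m {f g : ℕ → A} n → (∀ k → k ≤ n → f k ≡ g k) →
               shift z m f n ≡ shift z m g n
shift-cong-≤ zero    n       eq = eq n ≤-refl
shift-cong-≤ (suc m) zero    eq = refl
shift-cong-≤ (suc m) (suc n) eq = shift-cong-≤ m n λ k k≤n → eq k (m≤n⇒m≤1+n k≤n)

-- A shift by at least one reads only strictly earlier values. This is what makes stability,
-- cancellation and the count of distinct parts work at index `n`.
shift-cong-< : ∀ {z : A} m {f g : ℕ → A} n → (∀ k → k < n → f k ≡ g k) →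
               shift z (suc m) f n ≡ shift z (suc m) g n
shift-cong-< m zero    eq = refl
shift-cong-< m (suc n) eq = shift-cong-≤ m n λ k k≤n → eq k (s≤s k≤n)

shift-cong : ∀ {z : A} m {f g : ℕ → A} → f ≗ g → shift z m f ≗ shift z m g
shift-cong m eq n = shift-cong-≤ m n λ k _ → eq k

shift-> : ∀ {z : A} {m n} (f : ℕ → A) → n < m → shift z m f n ≡ z
shift-> {n = zero}  f (s≤s _)   = refl
shift-> {n = suc n} f (s≤s n<m) = shift-> f n<m

q^-+ : ∀ m k f → q^ m · q^ k · f ≗ q^ (m + k) · f
q^-+ zero    k f n       = refl
q^-+ (suc m) k f zero    = refl
q^-+ (suc m) k f (suc n) = q^-+ m k f n

q^-comm : ∀ m k f → q^ m · q^ k · f ≗ q^ k · q^ m · f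
q^-comm m k f n = begin
  (q^ m · q^ k · f) n ≡⟨ q^-+ m k f n ⟩
  (q^ (m + k) · f) n  ≡⟨ cong (λ e → (q^ e · f) n) (+-comm m k) ⟩
  (q^ (k + m) · f) n  ≡⟨ q^-+ k m f n ⟨
  (q^ k · q^ m · f) n ∎
  where open ≡-Reasoning

q^-⊕ : ∀ m f g → q^ m · (f ⊕ g) ≗ (q^ m · f) ⊕ (q^ m · g)
q^-⊕ zero    f g n       = refl
q^-⊕ (suc m) f g zero    = refl
q^-⊕ (suc m) f g (suc n) = q^-⊕ m f g n

q^-0 : ∀ m n → (q^ m · λ _ → 0) n ≡ 0
q^-0 zero    n       = refl
q^-0 (suc m) zero    = refl
q^-0 (suc m) (suc n) = q^-0 m n

q^-mono : ∀ m → (∀ n → f n ≤ g n) → ∀ n → (q^ m · f) n ≤ (q^ m · g) n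
q^-mono zero    f≤g n       = f≤g n
q^-mono (suc m) f≤g zero    = z≤n
q^-mono (suc m) f≤g (suc n) = q^-mono m f≤g n

-- Multiplication by 1 + q^m + ⋯ + q^((c-1)m).
geo : ℕ → ℕ → (ℕ → ℕ) → ℕ → ℕ
geo zero    m f n = 0
geo (suc c) m f n = f n + (q^ m · geo c m f) n

geo-cong-≤ : ∀ c m n → (∀ k → k ≤ n → f k ≡ g k) → geo c m f n ≡ geo c m g n
geo-cong-≤ zero    m n eq = refl
geo-cong-≤ (suc c) m n eq = cong₂ _+_ (eq n ≤-refl)
  (shift-cong-≤ m n λ k k≤n → geo-cong-≤ c m k λ l l≤k → eq l (≤-trans l≤k k≤n))

geo-cong : ∀ c m → f ≗ g → geo c m f ≗ geo c m g
geo-cong c m eq n = geo-cong-≤ c m n λ k _ → eq k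

geo-0 : ∀ c m n → geo c m (λ _ → 0) n ≡ 0
geo-0 zero    m n = refl
geo-0 (suc c) m n = trans (shift-cong m (geo-0 c m) n) (q^-0 m n)

geo-⊕ : ∀ c m f g → geo c m (f ⊕ g) ≗ geo c m f ⊕ geo c m g
geo-⊕ zero    m f g n = refl
geo-⊕ (suc c) m f g n = begin
  f n + g n + (q^ m · geo c m (f ⊕ g)) n
    ≡⟨ cong (f n + g n +_) (trans (shift-cong m (geo-⊕ c m f g) n) (q^-⊕ m _ _ n)) ⟩
  f n + g n + ((q^ m · geo c m f) n + (q^ m · geo c m g) n)
    ≡⟨ interchange (f n) (g n) _ _ ⟩
  geo (suc c) m f n + geo (suc c) m g n ∎
  where open ≡-Reasoning

q^-geo : ∀ k c m f → q^ k · geo c m f ≗ geo c m (q^ k · f)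
q^-geo k zero    m f n = q^-0 k n
q^-geo k (suc c) m f n = begin
  (q^ k · geo (suc c) m f) n
    ≡⟨ q^-⊕ k f (q^ m · geo c m f) n ⟩
  (q^ k · f) n + (q^ k · q^ m · geo c m f) n
    ≡⟨ cong ((q^ k · f) n +_) (q^-comm k m _ n) ⟩
  (q^ k · f) n + (q^ m · q^ k · geo c m f) n
    ≡⟨ cong ((q^ k · f) n +_) (shift-cong m (q^-geo k c m f) n) ⟩
  geo (suc c) m (q^ k · f) n ∎
  where open ≡-Reasoning

geo-comm : ∀ c m d k f → geo c m (geo d k f) ≗ geo d k (geo c m f)
geo-comm zero    m d k f n = sym (geo-0 d k n)
geo-comm (suc c) m d k f n = begin
  geo d k f n + (q^ m · geo c m (geo d k f)) n
    ≡⟨ cong (geo d k f n +_) (shift-cong m (geo-comm c m d k f) n) ⟩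
  geo d k f n + (q^ m · geo d k (geo c m f)) n
    ≡⟨ cong (geo d k f n +_) (q^-geo m d k _ n) ⟩
  geo d k f n + geo d k (q^ m · geo c m f) n
    ≡⟨ geo-⊕ d k f (q^ m · geo c m f) n ⟨
  geo d k (geo (suc c) m f) n ∎
  where open ≡-Reasoning

geo-+ : ∀ c d m f → geo (c + d) m f ≗ geo c m f ⊕ q^ (c * m) · geo d m f
geo-+ zero    d m f n = refl
geo-+ (suc c) d m f n = begin
  f n + (q^ m · geo (c + d) m f) n
    ≡⟨ cong (f n +_) (shift-cong m (geo-+ c d m f) n) ⟩
  f n + (q^ m · (geo c m f ⊕ q^ (c * m) · geo d m f)) n
    ≡⟨ cong (f n +_) (q^-⊕ m _ _ n) ⟩
  f n + ((q^ m · geo c m f) n + (q^ m · q^ (c * m) · geo d m f) n)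
    ≡⟨ +-assoc (f n) _ _ ⟨
  geo (suc c) m f n + (q^ m · q^ (c * m) · geo d m f) n
    ≡⟨ cong (geo (suc c) m f n +_) (q^-+ m (c * m) _ n) ⟩
  geo (suc c) m f n + (q^ (suc c * m) · geo d m f) n ∎
  where open ≡-Reasoning

geo-snoc : ∀ c m f → geo (suc c) m f ≗ geo c m f ⊕ q^ (c * m) · f
geo-snoc c m f n = begin
  geo (suc c) m f n
    ≡⟨ cong (λ e → geo e m f n) (+-comm 1 c) ⟩
  geo (c + 1) m f n
    ≡⟨ geo-+ c 1 m f n ⟩
  geo c m f n + (q^ (c * m) · geo 1 m f) n
    ≡⟨ cong (geo c m f n +_) (shift-cong (c * m) (λ k → trans (cong (f k +_) (q^-0 m k)) (+-identityʳ (f k))) n) ⟩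
  geo c m f n + (q^ (c * m) · f) n ∎
  where open ≡-Reasoning

-- Division with remainder by `c`: each exponent below `d * c` is uniquely `r + c * k` with `r < c`
-- and `k < d`. As fractions, the factor 1 - q^(cm) cancels.
geo-* : ∀ c d m f → geo c m (geo d (c * m) f) ≗ geo (d * c) m f
geo-* c zero    m f n = geo-0 c m n
geo-* c (suc d) m f n = begin
  geo c m (f ⊕ q^ (c * m) · geo d (c * m) f) n
    ≡⟨ geo-⊕ c m f _ n ⟩
  geo c m f n + geo c m (q^ (c * m) · geo d (c * m) f) n
    ≡⟨ cong (geo c m f n +_) (q^-geo (c * m) c m _ n) ⟨
  geo c m f n + (q^ (c * m) · geo c m (geo d (c * m) f)) n
    ≡⟨ cong (geo c m f n +_) (shift-cong (c * m) (geo-* c d m f) n) ⟩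
  geo c m f n + (q^ (c * m) · geo (d * c) m f) n
    ≡⟨ geo-+ c (d * c) m f n ⟨
  geo (c + d * c) m f n ∎
  where open ≡-Reasoning

-- The terms on which the two sums differ have exponent greater than `n`, because the step `suc m`
-- is positive.
geo-stable : ∀ {c d} m f {n} → n < c → n < d → geo c (suc m) f n ≡ geo d (suc m) f n
geo-stable {suc c} {suc d} m f {n} (s≤s n≤c) (s≤s n≤d) =
  cong (f n +_) (shift-cong-< m n λ k k<n →
    geo-stable m f (<-≤-trans k<n n≤c) (<-≤-trans k<n n≤d))

geo-< : ∀ {c m n} f → 0 < c → n < m → geo c m f n ≡ f n
geo-< {suc c} {n = n} f _ n<m =
  trans (cong (f n +_) (shift-> _ n<m)) (+-identityʳ (f n))

-- The factor has constant term 1, so coefficient `n` of the product is `f n` plus a combination of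
-- earlier coefficients of `f`; strong induction recovers `f n`.
geo-cancel : ∀ c m {f g} N → (∀ n → n ≤ N → geo (suc c) (suc m) f n ≡ geo (suc c) (suc m) g n) →
             ∀ n → n ≤ N → f n ≡ g n
geo-cancel c m {f} {g} N eq = <-rec _ step
  where
  step : ∀ n → (∀ {k} → k < n → k ≤ N → f k ≡ g k) → n ≤ N → f n ≡ g n
  step n ih n≤N = +-cancelʳ-≡ _ (f n) (g n) (trans (eq n n≤N) (cong (g n +_) (sym tails)))
    where
    tails : (q^ suc m · geo c (suc m) f) n ≡ (q^ suc m · geo c (suc m) g) n
    tails = shift-cong-< m n λ k k<n → geo-cong-≤ c (suc m) k λ l l≤k →
      ih (≤-<-trans l≤k k<n) (≤-trans (<⇒≤ (≤-<-trans l≤k k<n)) n≤N)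

geo-mono : ∀ {c d} m → c ≤ d → (∀ n → f n ≤ g n) → ∀ n → geo c m f n ≤ geo d m g n
geo-mono m z≤n       f≤g n = z≤n
geo-mono m (s≤s c≤d) f≤g n = +-mono-≤ (f≤g n) (q^-mono m (geo-mono m c≤d f≤g) n)

-- Glaisher's identity

unless : Dec X → A → A → A
unless (yes _) x y = x
unless (no _)  x y = y

unless-yes : (p? : Dec X) (x y : A) → X → unless p? x y ≡ x
unless-yes (yes _) x y p = refl
unless-yes (no ¬p) x y p = contradiction p ¬p

unless-no : (p? : Dec X) (x y : A) → ¬ X → unless p? x y ≡ y
unless-no (yes p) x y ¬p = contradiction p ¬p
unless-no (no _)  x y ¬p = refl

∤-between : ∀ {s} r N → r < s → suc s ∤ suc (r + N * suc s)
∤-between {s} r N r<s d = >⇒∤ (s≤s r<s) (∣m+n∣m⇒∣n (subst (suc s ∣_) (+-comm (suc r) (N * suc s)) d) (n∣m*n N))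

Operator : Set
Operator = (ℕ → ℕ) → ℕ → ℕ

-- Stands in for being multiplication by a power series. Commuting with the geometric factors is
-- enough to reorder every product below, so no general convolution is introduced.
record CommutesWithGeo (φ : Operator) : Set where
  constructor commutesWithGeo
  field
    op-cong : f ≗ g → φ f ≗ φ g
    op-geo  : ∀ c m f → geo c m (φ f) ≗ φ (geo c m f)

open CommutesWithGeo

geo-commutes : ∀ c m → CommutesWithGeo (geo c m)
geo-commutes c m = commutesWithGeo (geo-cong c m) (λ d k → geo-comm d k c m)

regularGeo : (t c m : ℕ) → Operator
regularGeo t c m f = unless (t ∣? m) f (geo c m f)

regularGeo-∣ : ∀ {t m} c f → t ∣ m → regularGeo t c m f ≗ f
regularGeo-∣ {t} {m} c f t∣m n = cong-app (unless-yes (t ∣? m) f (geo c m f) t∣m) n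

regularGeo-∤ : ∀ {t m} c f → t ∤ m → regularGeo t c m f ≗ geo c m f
regularGeo-∤ {t} {m} c f t∤m n = cong-app (unless-no (t ∣? m) f (geo c m f) t∤m) n

regularGeo-commutes : ∀ t c m → CommutesWithGeo (regularGeo t c m)
regularGeo-commutes t c m with t ∣? m
... | yes _ = commutesWithGeo id (λ _ _ _ _ → refl)
... | no  _ = geo-commutes c m

∏ : (ℕ → Operator) → ℕ → Operator
∏ φ zero    f = f
∏ φ (suc N) f = φ N (∏ φ N f)

∏-commutes : ∀ {φ} → (∀ m → CommutesWithGeo (φ m)) → ∀ N → CommutesWithGeo (∏ φ N)
∏-commutes φ-comm zero    = commutesWithGeo id (λ _ _ _ _ → refl)
∏-commutes φ-comm (suc N) = commutesWithGeo
  (op-cong (φ-comm N) ∘ op-cong (∏-commutes φ-comm N))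
  (λ c m f n → trans (op-geo (φ-comm N) c m _ n)
                     (op-cong (φ-comm N) (op-geo (∏-commutes φ-comm N) c m f) n))

regularProduct : (t c N : ℕ) → Operator
regularProduct t c = ∏ (λ m → regularGeo t c (suc m))

regularProduct-commutes : ∀ t c N → CommutesWithGeo (regularProduct t c N)
regularProduct-commutes t c = ∏-commutes (λ m → regularGeo-commutes t c (suc m))

-- Multiplication by the generating function of partitions with parts among the `e m`, each used
-- fewer than `c` times. The exponents `e` will be all positive integers, the multiples of `t`, or
-- the integers from 2 on.
geoProduct : (c : ℕ) → (ℕ → ℕ) → ℕ → Operator
geoProduct c e = ∏ (λ m → geo c (e m))

geoProduct-commutes : ∀ c e N → CommutesWithGeo (geoProduct c e N)
geoProduct-commutes c e = ∏-commutes (λ m → geo-commutes c (e m))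

geoProduct-geoProduct : ∀ {φ} c e N → CommutesWithGeo φ → ∀ f →
                        geoProduct c e N (φ f) ≗ φ (geoProduct c e N f)
geoProduct-geoProduct c e zero    φ-comm f n = refl
geoProduct-geoProduct c e (suc N) φ-comm f n =
  trans (geo-cong c (e N) (geoProduct-geoProduct c e N φ-comm f) n) (op-geo φ-comm c (e N) _ n)

-- A factor for a part larger than `n` is 1 up to q^n.
geoProduct-extend : ∀ c d {N n} f → n ≤ N → geoProduct (suc c) suc (d + N) f n ≡ geoProduct (suc c) suc N f n
geoProduct-extend c zero    f n≤N = refl
geoProduct-extend c (suc d) {N} f n≤N =
  trans (geo-< {suc c} (geoProduct (suc c) suc (d + N) f) (s≤s z≤n) (s≤s (≤-trans n≤N (m≤n+m N d)))) (geoProduct-extend c d f n≤N)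

geoProduct-stable : ∀ {c d} N f {n} → n < c → n < d → geoProduct c suc N f n ≡ geoProduct d suc N f n
geoProduct-stable zero    f n<c n<d = refl
geoProduct-stable {c} {d} (suc N) f {n} n<c n<d =
  trans (geo-cong-≤ c (suc N) n (λ k k≤n → geoProduct-stable N f (≤-<-trans k≤n n<c) (≤-<-trans k≤n n<d)))
        (geo-stable N _ n<c n<d)

geoProduct-cancel : ∀ c e M {f g} N →
  (∀ n → n ≤ N → geoProduct (suc c) (suc ∘ e) M f n ≡ geoProduct (suc c) (suc ∘ e) M g n) →
  ∀ n → n ≤ N → f n ≡ g n
geoProduct-cancel c e zero    N eq = eq
geoProduct-cancel c e (suc M) N eq = geoProduct-cancel c e M N (geo-cancel c (e M) N eq)

-- Factor by factor this is `geo-*`: bounding multiplicities of i by `t` and those of it by `c`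
-- amounts to bounding multiplicities of i by `c * t`.
geoProduct-* : ∀ t c N f → geoProduct t suc N (geoProduct c (λ m → suc m * t) N f) ≗ geoProduct (c * t) suc N f
geoProduct-* t c zero    f n = refl
geoProduct-* t c (suc N) f n = begin
  geo t (suc N) (geoProduct t suc N (geo c (suc N * t) E)) n
    ≡⟨ geo-cong t (suc N) (op-geo (geoProduct-commutes t suc N) c (suc N * t) E) n ⟨
  geo t (suc N) (geo c (suc N * t) (geoProduct t suc N E)) n
    ≡⟨ geo-cong t (suc N) (geo-cong c (suc N * t) (geoProduct-* t c N f)) n ⟩
  geo t (suc N) (geo c (suc N * t) (geoProduct (c * t) suc N f)) n
    ≡⟨ cong (λ e → geo t (suc N) (geo c e (geoProduct (c * t) suc N f)) n) (*-comm (suc N) t) ⟩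
  geo t (suc N) (geo c (t * suc N) (geoProduct (c * t) suc N f)) n
    ≡⟨ geo-* t c (suc N) _ n ⟩
  geoProduct (c * t) suc (suc N) f n ∎
  where
  open ≡-Reasoning
  E : ℕ → ℕ
  E = geoProduct c (λ m → suc m * t) N f

module _ (s c : ℕ) where
  private
    t = suc s
    multiples = λ m → suc m * t

  -- None of the next `s` integers after `N * t` is a multiple of `t`, so both products acquire the
  -- same factors.
  geoProduct-block : ∀ N f g → geoProduct c suc (N * t) f ≗ regularProduct t c (N * t) g →
    ∀ r → r ≤ s → geoProduct c suc (r + N * t) f ≗ regularProduct t c (r + N * t) g
  geoProduct-block N f g eq zero    r≤s = eq
  geoProduct-block N f g eq (suc r) r<s n =
    trans (geo-cong c _ (geoProduct-block N f g eq r (<⇒≤ r<s)) n)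
          (sym (regularGeo-∤ c (regularProduct t c (r + N * t) g) (∤-between r N r<s) n))

  -- The induction advances one block of `t` factors at a time; the factor closing the block belongs
  -- to a multiple of `t` and is moved inside, past the regular product.
  geoProduct-split : ∀ N f → geoProduct c suc (N * t) f ≗
                             regularProduct t c (N * t) (geoProduct c multiples N f)
  geoProduct-split zero    f n = refl
  geoProduct-split (suc N) f n = begin
    -- `suc N * t` computes to `suc (s + N * t)`, so the outermost factor is the one at the multiple
    -- of `t`.
    geo c (suc N * t) (geoProduct c suc (s + N * t) f) n
      ≡⟨ geo-cong c (suc N * t) (geoProduct-block N f _ (geoProduct-split N f) s ≤-refl) n ⟩
    geo c (suc N * t) (regularProduct t c (s + N * t) (geoProduct c multiples N f)) n
      ≡⟨ op-geo (regularProduct-commutes t c (s + N * t)) c (suc N * t) _ n ⟩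
    regularProduct t c (s + N * t) (geoProduct c multiples (suc N) f) n
      ≡⟨ regularGeo-∣ {t} {suc N * t} c (regularProduct t c (s + N * t) (geoProduct c multiples (suc N) f)) (n∣m*n (suc N)) n ⟨
    regularProduct t c (suc N * t) (geoProduct c multiples (suc N) f) n ∎
    where open ≡-Reasoning

-- Multiply both sides by the product `E` over multiples of `t`. The left side becomes the product
-- over all parts, and so does the right side by `geoProduct-*`, with another multiplicity bound
-- that is invisible up to q^N; then cancel `E`.
glaisher : ∀ s c N f {n} → n ≤ N → N ≤ c →
           regularProduct (suc s) (suc c) (N * suc s) f n ≡ geoProduct (suc s) suc N f n
glaisher s c N f n≤N N≤c = geoProduct-cancel c (λ m → s + m * t) N N eq _ n≤N
  where
  t = suc s
  E = geoProduct (suc c) (λ m → suc m * t) N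
  eq : ∀ n → n ≤ N → E (regularProduct t (suc c) (N * t) f) n ≡ E (geoProduct t suc N f) n
  eq n n≤N = begin
    E (regularProduct t (suc c) (N * t) f) n
      ≡⟨ geoProduct-geoProduct (suc c) (λ m → suc m * t) N (regularProduct-commutes t (suc c) (N * t)) f n ⟩
    regularProduct t (suc c) (N * t) (E f) n
      ≡⟨ geoProduct-split s (suc c) N f n ⟨
    geoProduct (suc c) suc (N * t) f n
      -- Since `N ≤ N * t`, the factors beyond the first `N` can be split off and dropped.
      ≡⟨ cong (λ L → geoProduct (suc c) suc L f n) (m∸n+n≡m (m≤m*n N t)) ⟨
    geoProduct (suc c) suc (N * t ∸ N + N) f n
      ≡⟨ geoProduct-extend c (N * t ∸ N) f n≤N ⟩
    geoProduct (suc c) suc N f n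
      -- Both multiplicity bounds, `suc c` and `suc c * t`, exceed `n`.
      ≡⟨ geoProduct-stable N f n<c (<-≤-trans n<c (m≤m*n (suc c) t)) ⟩
    geoProduct (suc c * t) suc N f n
      ≡⟨ geoProduct-* t (suc c) N f n ⟨
    geoProduct t suc N (E f) n
      ≡⟨ geoProduct-geoProduct (suc c) (λ m → suc m * t) N (geoProduct-commutes t suc N) f n ⟨
    E (geoProduct t suc N f) n ∎
    where
    open ≡-Reasoning
    n<c : n < suc c
    n<c = s≤s (≤-trans n≤N N≤c)

-- `∏` peels off the largest index, whereas the factor for i = 1 is the one that has to meet 1 / (1
-- - q^t).
geoProduct-head : ∀ c N f → geoProduct c suc (suc N) f ≗ geo c 1 (geoProduct c (suc ∘ suc) N f)
geoProduct-head c zero    f n = refl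
geoProduct-head c (suc N) f n =
  trans (geo-cong c (2 + N) (geoProduct-head c N f) n) (geo-comm c (2 + N) c 1 _ n)

geoProduct-mono : ∀ {c d} e N → c ≤ d → (f : ℕ → ℕ) → ∀ n → geoProduct c e N f n ≤ geoProduct d e N f n
geoProduct-mono e zero    c≤d f n = ≤-refl
geoProduct-mono e (suc N) c≤d f n = geo-mono (e N) c≤d (geoProduct-mono e N c≤d f) n

-- The series counting distinct parts

-- Multiplication by the sum of the q^m with `m ≤ N` and `t ∤ m`, a truncation of (q + ⋯ + q^(t-1))
-- / (1 - q^t).
regularSum : (t N : ℕ) → Operator
regularSum t zero    f n = 0
regularSum t (suc N) f n = unless (t ∣? suc N) (regularSum t N f n) (regularSum t N f n + (q^ suc N · f) n)

regularSum-commutes : ∀ t N → CommutesWithGeo (regularSum t N)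
regularSum-commutes t zero    = commutesWithGeo (λ _ _ → refl) (λ c m _ → geo-0 c m)
regularSum-commutes t (suc N) with t ∣? suc N
... | yes _ = commutesWithGeo (op-cong (regularSum-commutes t N)) (op-geo (regularSum-commutes t N))
... | no  _ = commutesWithGeo
  (λ eq n → cong₂ _+_ (op-cong (regularSum-commutes t N) eq n) (shift-cong (suc N) eq n))
  (λ c m f n → trans (geo-⊕ c m (regularSum t N f) (q^ suc N · f) n)
                     (cong₂ _+_ (op-geo (regularSum-commutes t N) c m f n)
                                (sym (q^-geo (suc N) c m f n))))

module _ (s : ℕ) (f : ℕ → ℕ) where
  private
    t = suc s

  regularSum-block : ∀ N i → i ≤ s →
    regularSum t (i + N * t) f ≗ regularSum t (N * t) f ⊕ q^ (N * t) · q^ 1 · geo i 1 f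
  regularSum-block N zero    i≤s n =
    sym (trans (cong (regularSum t (N * t) f n +_)
                     (trans (shift-cong (N * t) (q^-0 1) n) (q^-0 (N * t) n)))
               (+-identityʳ _))
  regularSum-block N (suc i) i<s n = begin
    regularSum t (suc i + N * t) f n
      ≡⟨ unless-no (t ∣? suc (i + N * t)) _ _ (∤-between i N i<s) ⟩
    regularSum t (i + N * t) f n + (q^ suc (i + N * t) · f) n
      ≡⟨ cong₂ _+_ (regularSum-block N i (<⇒≤ i<s) n) (last-term n) ⟩
    regularSum t (N * t) f n + (q^ (N * t) · q^ 1 · geo i 1 f) n + (q^ (N * t) · q^ 1 · q^ (i * 1) · f) n
      ≡⟨ +-assoc (regularSum t (N * t) f n) _ _ ⟩
    regularSum t (N * t) f n + ((q^ (N * t) · q^ 1 · geo i 1 f) n + (q^ (N * t) · q^ 1 · q^ (i * 1) · f) n)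
      ≡⟨ cong (regularSum t (N * t) f n +_) (combine n) ⟨
    regularSum t (N * t) f n + (q^ (N * t) · q^ 1 · geo (suc i) 1 f) n ∎
    where
    open ≡-Reasoning
    last-term : q^ suc (i + N * t) · f ≗ q^ (N * t) · q^ 1 · q^ (i * 1) · f
    last-term k = sym (begin
      (q^ (N * t) · q^ 1 · q^ (i * 1) · f) k ≡⟨ shift-cong (N * t) (q^-+ 1 (i * 1) f) k ⟩
      (q^ (N * t) · q^ suc (i * 1) · f) k    ≡⟨ q^-+ (N * t) _ f k ⟩
      (q^ (N * t + suc (i * 1)) · f) k       ≡⟨ cong (λ e → (q^ e · f) k) (+-comm (N * t) _) ⟩
      (q^ suc (i * 1 + N * t) · f) k         ≡⟨ cong (λ e → (q^ suc (e + N * t) · f) k) (*-identityʳ i) ⟩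
      (q^ suc (i + N * t) · f) k             ∎)
    combine : q^ (N * t) · q^ 1 · geo (suc i) 1 f ≗
              (q^ (N * t) · q^ 1 · geo i 1 f) ⊕ (q^ (N * t) · q^ 1 · q^ (i * 1) · f)
    combine k = begin
      (q^ (N * t) · q^ 1 · geo (suc i) 1 f) k
        ≡⟨ shift-cong (N * t) (λ l → trans (shift-cong 1 (geo-snoc i 1 f) l) (q^-⊕ 1 _ _ l)) k ⟩
      (q^ (N * t) · ((q^ 1 · geo i 1 f) ⊕ (q^ 1 · q^ (i * 1) · f))) k
        ≡⟨ q^-⊕ (N * t) _ _ k ⟩
      (q^ (N * t) · q^ 1 · geo i 1 f) k + (q^ (N * t) · q^ 1 · q^ (i * 1) · f) k ∎

  -- Writes each non-multiple of `t` below `N * t` as a multiple of `t` plus a remainder from 1 to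
  -- `s`; `geo N t` collects the multiples and `q^ 1 · geo s 1` the remainders.
  regularSum-multiple : ∀ N → regularSum t (N * t) f ≗ q^ 1 · geo s 1 (geo N t f)
  regularSum-multiple zero    n = sym (trans (shift-cong 1 (geo-0 s 1) n) (q^-0 1 n))
  regularSum-multiple (suc N) n = begin
    regularSum t (suc N * t) f n
      ≡⟨ unless-yes (t ∣? suc N * t) _ _ (n∣m*n (suc N)) ⟩
    regularSum t (s + N * t) f n
      ≡⟨ regularSum-block N s ≤-refl n ⟩
    regularSum t (N * t) f n + (q^ (N * t) · q^ 1 · geo s 1 f) n
      ≡⟨ cong₂ _+_ (regularSum-multiple N n) (shift-into n) ⟩
    (q^ 1 · geo s 1 (geo N t f)) n + (q^ 1 · geo s 1 (q^ (N * t) · f)) n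
      ≡⟨ q^-⊕ 1 _ _ n ⟨
    (q^ 1 · (geo s 1 (geo N t f) ⊕ geo s 1 (q^ (N * t) · f))) n
      ≡⟨ shift-cong 1 (λ k → trans (geo-cong s 1 (geo-snoc N t f) k) (geo-⊕ s 1 _ _ k)) n ⟨
    (q^ 1 · geo s 1 (geo (suc N) t f)) n ∎
    where
    open ≡-Reasoning
    shift-into : q^ (N * t) · q^ 1 · geo s 1 f ≗ q^ 1 · geo s 1 (q^ (N * t) · f)
    shift-into k = trans (q^-comm (N * t) 1 _ k) (shift-cong 1 (q^-geo (N * t) s 1 f) k)

one : ℕ → ℕ
one zero    = 1
one (suc n) = 0

regularSum-regularProduct : ∀ s c N f {n} → n ≤ suc N → suc N ≤ c →
  regularSum (suc s) (suc N * suc s) (regularProduct (suc s) (suc c) (suc N * suc s) f) n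
  ≡ (q^ 1 · geo s 1 (geo (suc N * suc s) 1 (geoProduct (suc s) (suc ∘ suc) N f))) n
regularSum-regularProduct s c N f {n} n≤N N≤c = begin
  regularSum t (suc N * t) P n
    ≡⟨ regularSum-multiple s P (suc N) n ⟩
  (q^ 1 · geo s 1 (geo (suc N) t P)) n
    -- The operators in front read only indices up to `n`, where the truncated Glaisher identity is
    -- available.
    ≡⟨ shift-cong-≤ 1 n (λ k k≤n → geo-cong-≤ s 1 k λ l l≤k → geo-cong-≤ (suc N) t l λ j j≤l →
         trans (glaisher s c (suc N) f (≤-trans j≤l (≤-trans l≤k (≤-trans k≤n n≤N))) N≤c)
               (geoProduct-head t N f j)) ⟩
  (q^ 1 · geo s 1 (geo (suc N) t (geo t 1 R))) n
    ≡⟨ shift-cong 1 (geo-cong s 1 (λ k → trans (geo-comm (suc N) t t 1 R k) (telescope k))) n ⟩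
  (q^ 1 · geo s 1 (geo (suc N * t) 1 R)) n ∎
  where
  open ≡-Reasoning
  t = suc s
  P = regularProduct t (suc c) (suc N * t) f
  R = geoProduct t (suc ∘ suc) N f
  -- The factor (1 - q^t) / (1 - q) for i = 1 turns the truncated 1 / (1 - q^t) into a truncated 1 /
  -- (1 - q).
  telescope : geo t 1 (geo (suc N) t R) ≗ geo (suc N * t) 1 R
  telescope k = trans (cong (λ e → geo t 1 (geo (suc N) e R) k) (sym (*-identityʳ t)))
                      (geo-* t (suc N) 1 R k)

-- Enumeration of regular partitions

∈-shift⁻ : ∀ m (F : ℕ → List A) n {x} → x ∈ shift [] m F n → ∃[ k ] m + k ≡ n × x ∈ F k
∈-shift⁻ zero    F n       x∈ = n , refl , x∈
∈-shift⁻ (suc m) F zero    ()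
∈-shift⁻ (suc m) F (suc n) x∈ with k , eq , x∈F ← ∈-shift⁻ m F n x∈ = k , cong suc eq , x∈F

∈-shift⁺ : ∀ m (F : ℕ → List A) {k x} → x ∈ F k → x ∈ shift [] m F (m + k)
∈-shift⁺ zero    F x∈ = x∈
∈-shift⁺ (suc m) F x∈ = ∈-shift⁺ m F x∈

shift-preserves : (Q : A → Set) → ∀ {z} m {f : ℕ → A} → Q z → (∀ k → Q (f k)) → ∀ n → Q (shift z m f n)
shift-preserves Q zero    Qz Qf n       = Qf n
shift-preserves Q (suc m) Qz Qf zero    = Qz
shift-preserves Q (suc m) Qz Qf (suc n) = shift-preserves Q m Qz Qf n

Enumeration : Set
Enumeration = ℕ → List (List ℕ)

-- Prepends 0 to `c - 1` copies of `m`. The recursion copies that of `geo`, so that taking lengths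
-- turns one into the other.
extend : (c m : ℕ) → Enumeration → Enumeration
extend zero    m L n = []
extend (suc c) m L n = L n ++ shift [] m (λ k → map (m ∷_) (extend c m L k)) n

-- Bounding multiplicities by c turns every factor of the generating function
-- into a polynomial; the bound is vacuous for partitions of n < c.
enumerate : (t c N : ℕ) → Enumeration
enumerate t c zero    zero    = [] ∷ []
enumerate t c zero    (suc n) = []
enumerate t c (suc N) = unless (t ∣? suc N) (enumerate t c N) (extend c (suc N) (enumerate t c N))

length-extend : ∀ c m L → length ∘ extend c m L ≗ geo c m (length ∘ L)
length-extend zero    m L n = refl
length-extend (suc c) m L n = begin
  length (L n ++ shift [] m M n)
    ≡⟨ length-++ (L n) ⟩
  length (L n) + length (shift [] m M n)
    ≡⟨ cong (length (L n) +_) (shift-natural length [] m M n) ⟩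
  length (L n) + (q^ m · (length ∘ M)) n
    ≡⟨ cong (length (L n) +_) (shift-cong m (λ k → trans (length-map (m ∷_) (extend c m L k)) (length-extend c m L k)) n) ⟩
  geo (suc c) m (length ∘ L) n ∎
  where
  open ≡-Reasoning
  M : Enumeration
  M k = map (m ∷_) (extend c m L k)

length-enumerate : ∀ t c N → length ∘ enumerate t c N ≗ regularProduct t c N one
length-enumerate t c zero    zero    = refl
length-enumerate t c zero    (suc n) = refl
length-enumerate t c (suc N) n with t ∣? suc N
... | yes _ = length-enumerate t c N n
... | no  _ = trans (length-extend c (suc N) (enumerate t c N) n)
                    (geo-cong c (suc N) (length-enumerate t c N) n)

RegularPartitionUpTo : (t N n : ℕ) → List ℕ → Set
RegularPartitionUpTo t N n λs = IsRegularPartition t n λs × All (_≤ N) λs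

linked-∷ : ∀ {m λs} → All (_≤ m) λs → Linked _≥_ λs → Linked _≥_ (m ∷ λs)
linked-∷ []      []  = [-]
linked-∷ (p ∷ _) lnk = p ∷ lnk

∷-regularPartition : ∀ {t m n λs} → t ∤ suc m → RegularPartitionUpTo t (suc m) n λs →
                     RegularPartitionUpTo t (suc m) (suc m + n) (suc m ∷ λs)
∷-regularPartition {m = m} t∤m ((mkIsPartition lnk pos refl , reg) , bound) =
  (mkIsPartition (linked-∷ bound lnk) (s≤s z≤n ∷ pos) refl , t∤m ∷ reg) , ≤-refl ∷ bound

extend-sound : ∀ {t m L} → t ∤ suc m →
               (∀ {n λs} → λs ∈ L n → RegularPartitionUpTo t (suc m) n λs) →
               ∀ c {n λs} → λs ∈ extend c (suc m) L n → RegularPartitionUpTo t (suc m) n λs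
extend-sound {m = m} {L} t∤m sound zero ()
extend-sound {m = m} {L} t∤m sound (suc c) {n} λs∈ with ∈-++⁻ (L n) λs∈
... | inj₁ λs∈L = sound λs∈L
... | inj₂ λs∈S
  with k , refl , λs∈M ← ∈-shift⁻ (suc m) (λ k → map (suc m ∷_) (extend c (suc m) L k)) n λs∈S
  with μs , μs∈ , refl ← ∈-map⁻ (suc m ∷_) λs∈M
  = ∷-regularPartition t∤m (extend-sound t∤m sound c μs∈)

weaken-bound : ∀ {t N n λs} → RegularPartitionUpTo t N n λs → RegularPartitionUpTo t (suc N) n λs
weaken-bound (isReg , bound) = isReg , All.map m≤n⇒m≤1+n bound

enumerate-sound : ∀ t c N {n λs} → λs ∈ enumerate t c N n → RegularPartitionUpTo t N n λs
enumerate-sound t c zero {zero} (here refl) = (mkIsPartition [] [] refl , []) , []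
enumerate-sound t c (suc N) λs∈ with t ∣? suc N
... | yes _  = weaken-bound (enumerate-sound t c N λs∈)
... | no t∤N = extend-sound t∤N (weaken-bound ∘ enumerate-sound t c N) c λs∈

tail-regularPartition : ∀ {t N n p ps} → RegularPartitionUpTo t N n (p ∷ ps) →
                        RegularPartitionUpTo t N (sum ps) ps × p + sum ps ≡ n
tail-regularPartition ((mkIsPartition lnk (_ ∷ pos) eq , _ ∷ reg) , _ ∷ bound) =
  ((mkIsPartition (Linked.tail lnk) pos refl , reg) , bound) , eq

head-bound : ∀ {N p ps} → Linked _≥_ (p ∷ ps) → p ≤ N → All (_≤ N) (p ∷ ps)
head-bound lnk p≤N = All.map (λ q≤p → ≤-trans q≤p p≤N)
  (Linked.Linked⇒All (λ p≥q q≥r → ≤-trans q≥r p≥q) ≤-refl lnk)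

module _ {t b N : ℕ} {L : Enumeration}
         (complete : ∀ {n λs} → RegularPartitionUpTo t N n λs → length λs < b → λs ∈ L n) where

  -- Two length bounds are needed: `b` is the fixed one under which `L` is complete, while `c` drops
  -- by one with each copy of `suc N` removed.
  extend-complete : ∀ {c n} λs → RegularPartitionUpTo t (suc N) n λs → length λs < b → length λs < c →
                    λs ∈ extend c (suc N) L n
  extend-complete {suc c} [] (isReg , _) <b <c = ∈-++⁺ˡ (complete (isReg , []) <b)
  extend-complete {suc c} {n} (p ∷ ps) isReg@((isPart , reg) , p≤1+N ∷ _) <b <c with p ≟ suc N
  ... | no p≢1+N = ∈-++⁺ˡ (complete ((isPart , reg) ,
                     head-bound (nonincreasing isPart) (s≤s⁻¹ (≤∧≢⇒< p≤1+N p≢1+N))) <b)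
  ... | yes refl with isReg′ , refl ← tail-regularPartition isReg =
    ∈-++⁺ʳ (L n) (∈-shift⁺ (suc N) (λ k → map (suc N ∷_) (extend c (suc N) L k))
      (∈-map⁺ (suc N ∷_) (extend-complete ps isReg′ (<⇒≤ <b) (s≤s⁻¹ <c))))

enumerate-complete : ∀ t c N {n λs} → RegularPartitionUpTo t N n λs → length λs < c → λs ∈ enumerate t c N n
enumerate-complete t c zero {λs = []} ((mkIsPartition _ _ refl , _) , _) _ = here refl
enumerate-complete t c zero {λs = _ ∷ _} ((mkIsPartition _ (0<p ∷ _) _ , _) , p≤0 ∷ _) _ =
  contradiction (<-≤-trans 0<p p≤0) (<-irrefl refl)
enumerate-complete t c (suc N) isReg@((isPart , reg) , bound) <c with t ∣? suc N
... | no  _   = extend-complete (enumerate-complete t c N) _ isReg <c <c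
... | yes t∣N = enumerate-complete t c N ((isPart , reg) , All.zipWith lower (bound , reg)) <c
  where
  lower : ∀ {p} → p ≤ suc N × t ∤ p → p ≤ N
  lower (p≤1+N , t∤p) = s≤s⁻¹ (≤∧≢⇒< p≤1+N λ { refl → t∤p t∣N })

-- All parts in `L` are below `m`, so a list from `L` cannot begin with `m`, as those of the second
-- half do.
extend-unique : ∀ {m L} → (∀ n → Unique (L n)) → (∀ {n λs} → λs ∈ L n → All (_< m) λs) →
                ∀ c n → Unique (extend c m L n)
extend-unique uniq bound zero    n = []
extend-unique {m} {L} uniq bound (suc c) n =
  Unique.++⁺ (uniq n)
    (shift-preserves Unique m [] (λ k → Unique.map⁺ ∷-injectiveʳ (extend-unique uniq bound c k)) n)
    disjoint
  where
  disjoint : ∀ {λs} → λs ∈ L n × λs ∈ shift [] m (λ k → map (m ∷_) (extend c m L k)) n → ⊥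
  disjoint (λs∈L , λs∈S)
    with _ , _ , λs∈M ← ∈-shift⁻ m (λ k → map (m ∷_) (extend c m L k)) n λs∈S
    with _ , _ , refl ← ∈-map⁻ (m ∷_) λs∈M
    with m<m ∷ _ ← bound λs∈L
    = <-irrefl refl m<m

enumerate-< : ∀ t c N {n λs} → λs ∈ enumerate t c N n → All (_< suc N) λs
enumerate-< t c N λs∈ = All.map s≤s (proj₂ (enumerate-sound t c N λs∈))

enumerate-unique : ∀ t c N n → Unique (enumerate t c N n)
enumerate-unique t c zero zero    = [] ∷ []
enumerate-unique t c zero (suc n) = []
enumerate-unique t c (suc N) n with t ∣? suc N
... | yes _ = enumerate-unique t c N n
... | no  _ = extend-unique (enumerate-unique t c N) (enumerate-< t c N) c n

parts≤sum : ∀ λs → All (_≤ sum λs) λs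
parts≤sum []       = []
parts≤sum (p ∷ ps) = m≤m+n p (sum ps) ∷ All.map (λ q → ≤-trans q (m≤n+m (sum ps) p)) (parts≤sum ps)

length≤sum : ∀ {λs} → All (0 <_) λs → length λs ≤ sum λs
length≤sum []       = z≤n
length≤sum (p ∷ ps) = +-mono-≤ p (length≤sum ps)

-- Both lists are free of duplicates and have the same members: a partition of `n` has at most
-- `n < c` parts, each at most `n ≤ N`.
regularPartitions↭enumerate : ∀ t {c N n} → n < c → n ≤ N → regularPartitions t n ↭ enumerate t c N n
regularPartitions↭enumerate t {c} {N} {n} n<c n≤N =
  ∼bag⇒↭ (unique∧set⇒bag (regularPartitions-unique t n) (enumerate-unique t c N n) (mk⇔ to from))
  where
  to : ∀ {λs} → λs ∈ regularPartitions t n → λs ∈ enumerate t c N n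
  to {λs} λs∈ with isReg@(mkIsPartition _ pos refl , _) ← Equivalence.to (∈-regularPartitions t n λs) λs∈ =
    enumerate-complete t c N (isReg , All.map (λ p≤n → ≤-trans p≤n n≤N) (parts≤sum λs))
                       (≤-<-trans (length≤sum pos) n<c)
  from : ∀ {λs} → λs ∈ enumerate t c N n → λs ∈ regularPartitions t n
  from {λs} λs∈ = Equivalence.from (∈-regularPartitions t n λs) (proj₁ (enumerate-sound t c N λs∈))

-- Distinct parts of the enumerated partitions

newPart : ℕ → List ℕ → ℕ
newPart p []      = 1
newPart p (q ∷ _) = unless (p ≟ q) 0 1

-- Counts runs, hence distinct parts only for a nonincreasing list.
distinctParts : List ℕ → ℕ
distinctParts []       = 0
distinctParts (p ∷ ps) = newPart p ps + distinctParts ps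

distinctParts-new : ∀ {m λs} → All (_< m) λs → distinctParts (m ∷ λs) ≡ suc (distinctParts λs)
distinctParts-new []        = refl
distinctParts-new (q<m ∷ _) = cong (_+ _) (unless-no (_ ≟ _) 0 1 (>⇒≢ q<m))

distinctParts-repeat : ∀ m λs → distinctParts (m ∷ m ∷ λs) ≡ distinctParts (m ∷ λs)
distinctParts-repeat m λs = cong (_+ distinctParts (m ∷ λs)) (unless-yes (m ≟ m) 0 1 refl)

sum-map-suc : ∀ {f g : A → ℕ} {xs} → All (λ x → f x ≡ suc (g x)) xs →
              sum (map f xs) ≡ sum (map g xs) + length xs
sum-map-suc [] = refl
sum-map-suc {f = f} {g} {x ∷ xs} (eq ∷ eqs) = begin
  f x + sum (map f xs)                        ≡⟨ cong₂ _+_ eq (sum-map-suc eqs) ⟩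
  suc (g x + (sum (map g xs) + length xs))    ≡⟨ cong suc (+-assoc (g x) _ _) ⟨
  suc (g x + sum (map g xs) + length xs)      ≡⟨ +-suc _ _ ⟨
  g x + sum (map g xs) + suc (length xs)      ∎
  where open ≡-Reasoning

total : (List ℕ → ℕ) → List (List ℕ) → ℕ
total h λss = sum (map h λss)

total-shift : ∀ h m (M : Enumeration) → total h ∘ shift [] m (map (m ∷_) ∘ M) ≗ q^ m · (total (h ∘ (m ∷_)) ∘ M)
total-shift h m M n = trans (shift-natural (total h) [] m (map (m ∷_) ∘ M) n)
                            (shift-cong m (λ k → cong sum (sym (map-∘ (M k)))) n)

total-++-shift : ∀ h m (L M : Enumeration) n →
                 total h (L n ++ shift [] m (map (m ∷_) ∘ M) n) ≡
                 total h (L n) + (q^ m · (total (h ∘ (m ∷_)) ∘ M)) n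
total-++-shift h m L M n = begin
  sum (map h (L n ++ S))          ≡⟨ cong sum (map-++ h (L n) S) ⟩
  sum (map h (L n) ++ map h S)    ≡⟨ sum-++ (map h (L n)) (map h S) ⟩
  total h (L n) + total h S       ≡⟨ cong (total h (L n) +_) (total-shift h m M n) ⟩
  total h (L n) + (q^ m · (total (h ∘ (m ∷_)) ∘ M)) n ∎
  where
  open ≡-Reasoning
  S = shift [] m (map (m ∷_) ∘ M) n

module _ {m : ℕ} {L : Enumeration} (bound : ∀ {n λs} → λs ∈ L n → All (_< m) λs) where

  -- Once one `m` stands in front, further copies add nothing, so each list contributes the count of
  -- its remainder in `L` plus one, whatever the multiplicity of `m`.
  distinctParts-∷extend : ∀ c → total (distinctParts ∘ (m ∷_)) ∘ extend c m L ≗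
                                geo c m ((total distinctParts ∘ L) ⊕ (length ∘ L))
  distinctParts-∷extend zero    n = refl
  distinctParts-∷extend (suc c) n = begin
    total (distinctParts ∘ (m ∷_)) (extend (suc c) m L n)
      ≡⟨ total-++-shift (distinctParts ∘ (m ∷_)) m L (extend c m L) n ⟩
    total (distinctParts ∘ (m ∷_)) (L n) + (q^ m · (total (λ λs → distinctParts (m ∷ m ∷ λs)) ∘ extend c m L)) n
      ≡⟨ cong₂ _+_ (sum-map-suc (All.tabulate (distinctParts-new ∘ bound)))
           (shift-cong m (λ k → trans (cong sum (map-cong (distinctParts-repeat m) (extend c m L k)))
                                      (distinctParts-∷extend c k)) n) ⟩
    geo (suc c) m ((total distinctParts ∘ L) ⊕ (length ∘ L)) n ∎
    where open ≡-Reasoning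

  -- The second summand counts the lists that contain `m` at all, each of which gains `m` as one
  -- further distinct part.
  distinctParts-extend : ∀ c → total distinctParts ∘ extend (suc c) m L ≗
    geo (suc c) m (total distinctParts ∘ L) ⊕ q^ m · geo c m (length ∘ L)
  distinctParts-extend c n = begin
    total distinctParts (extend (suc c) m L n)
      ≡⟨ total-++-shift distinctParts m L (extend c m L) n ⟩
    D n + (q^ m · (total (distinctParts ∘ (m ∷_)) ∘ extend c m L)) n
      ≡⟨ cong (D n +_) (shift-cong m (λ k → trans (distinctParts-∷extend c k) (geo-⊕ c m D (length ∘ L) k)) n) ⟩
    D n + (q^ m · (geo c m D ⊕ geo c m (length ∘ L))) n
      ≡⟨ cong (D n +_) (q^-⊕ m _ _ n) ⟩
    D n + ((q^ m · geo c m D) n + (q^ m · geo c m (length ∘ L)) n)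
      ≡⟨ +-assoc (D n) _ _ ⟨
    geo (suc c) m D n + (q^ m · geo c m (length ∘ L)) n ∎
    where
    open ≡-Reasoning
    D : ℕ → ℕ
    D = total distinctParts ∘ L

distinctParts-enumerate : ∀ t c N {n} → n ≤ c →
  total distinctParts (enumerate t (suc c) N n) ≡ regularSum t N (regularProduct t (suc c) N one) n
distinctParts-enumerate t c zero {zero}  n≤c = refl
distinctParts-enumerate t c zero {suc n} n≤c = refl
distinctParts-enumerate t c (suc N) {n} n≤c with t ∣? suc N
... | yes _ = distinctParts-enumerate t c N n≤c
... | no  _ = begin
  total distinctParts (extend (suc c) m L n)
    ≡⟨ distinctParts-extend (enumerate-< t (suc c) N) c n ⟩
  geo (suc c) m (total distinctParts ∘ L) n + (q^ m · geo c m (length ∘ L)) n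
    ≡⟨ cong₂ _+_
         (geo-cong-≤ (suc c) m n λ k k≤n → distinctParts-enumerate t c N (≤-trans k≤n n≤c))
         -- After one copy of `m` is removed only `c` multiplicities remain, but at indices
         -- `k < n ≤ c` the bounds `c` and `suc c` agree.
         (shift-cong-< N n λ k k<n → trans
           (geo-cong c m (length-enumerate t (suc c) N) k)
           (geo-stable N P (<-≤-trans k<n n≤c) (m≤n⇒m≤1+n (<-≤-trans k<n n≤c)))) ⟩
  geo (suc c) m (regularSum t N P) n + (q^ m · geo (suc c) m P) n
    ≡⟨ cong (_+ (q^ m · geo (suc c) m P) n) (op-geo (regularSum-commutes t N) (suc c) m P n) ⟩
  regularSum t N (geo (suc c) m P) n + (q^ m · geo (suc c) m P) n ∎
  where
  open ≡-Reasoning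
  m = suc N
  L = enumerate t (suc c) N
  P = regularProduct t (suc c) N one

-- Hooks of length 1

length-filter-map : ∀ {P : B → Set} (P? : Decidable P) (f : A → B) xs →
                    length (filter P? (map f xs)) ≡ length (filter (P? ∘ f) xs)
length-filter-map P? f []       = refl
length-filter-map P? f (x ∷ xs) with P? (f x)
... | yes _ = cong suc (length-filter-map P? f xs)
... | no  _ = length-filter-map P? f xs

length-filter-++-map : ∀ {P : B → Set} (P? : Decidable P) xs (f : A → B) ys →
  length (filter P? (xs ++ map f ys)) ≡ length (filter P? xs) + length (filter (P? ∘ f) ys)
length-filter-++-map P? xs f ys = begin
  length (filter P? (xs ++ map f ys))
    ≡⟨ cong length (filter-++ P? xs (map f ys)) ⟩
  length (filter P? xs ++ filter P? (map f ys))
    ≡⟨ length-++ (filter P? xs) ⟩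
  length (filter P? xs) + length (filter P? (map f ys))
    ≡⟨ cong (length (filter P? xs) +_) (length-filter-map P? f ys) ⟩
  length (filter P? xs) + length (filter (P? ∘ f) ys) ∎
  where open ≡-Reasoning

right? : (x : Box) → Decidable (λ y → proj₁ y ≡ proj₁ x × proj₂ x < proj₂ y)
right? x y = proj₁ y ≟ proj₁ x ×-dec proj₂ x <? proj₂ y

below? : (x : Box) → Decidable (λ y → proj₂ y ≡ proj₂ x × proj₁ x < proj₁ y)
below? x y = proj₂ y ≟ proj₂ x ×-dec proj₁ x <? proj₁ y

hook1? : (λs : List ℕ) → Decidable (λ x → hookLength λs x ≡ 1)
hook1? λs x = hookLength λs x ≟ 1

-- Hooks extend right and down only, so the first row meets no hook of a lower box.
hookLength-suc : ∀ p ps i j → hookLength (p ∷ ps) (suc i , j) ≡ hookLength ps (i , j)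
hookLength-suc p ps i j = cong (_+ 1) (cong₂ _+_ right below)
  where
  open ≡-Reasoning
  row = map (0 ,_) (upTo p)
  right : length (boxesRight (p ∷ ps) (suc i , j)) ≡ length (boxesRight ps (i , j))
  right = trans (length-filter-++-map (right? (suc i , j)) row (map₁ suc) (youngDiagram ps))
    (cong₂ _+_
      (cong length (filter-none (right? (suc i , j)) (All.map⁺ (All.universal (λ _ ()) (upTo p)))))
      (cong length (filter-≐ (right? (suc i , j) ∘ map₁ suc) (right? (i , j)) ((λ { (refl , j<) → refl , j< }) , (λ { (refl , j<) → refl , j< })) (youngDiagram ps))))
  below : length (boxesBelow (p ∷ ps) (suc i , j)) ≡ length (boxesBelow ps (i , j))
  below = trans (length-filter-++-map (below? (suc i , j)) row (map₁ suc) (youngDiagram ps))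
    (cong₂ _+_
      (cong length (filter-none (below? (suc i , j)) (All.map⁺ (All.universal (λ { _ (_ , ()) }) (upTo p)))))
      (cong length (filter-≐ (below? (suc i , j) ∘ map₁ suc) (below? (i , j)) ((λ { (refl , s≤s i<) → refl , i< }) , (λ { (refl , i<) → refl , s≤s i< })) (youngDiagram ps))))

∈⇒0<length : ∀ {x : A} {xs} → x ∈ xs → 0 < length xs
∈⇒0<length {xs = _ ∷ _} _ = s≤s z≤n

hookLength>1-right : ∀ {p j} ps → suc j < p → hookLength (p ∷ ps) (0 , j) ≢ 1
hookLength>1-right {p} {j} ps j+1<p eq = <-irrefl (sym eq)
  (+-monoˡ-≤ 1 (≤-trans (∈⇒0<length box∈) (m≤m+n _ _)))
  where
  box∈ : (0 , suc j) ∈ boxesRight (p ∷ ps) (0 , j)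
  box∈ = ∈-filter⁺ (right? (0 , j)) (∈-++⁺ˡ (∈-map⁺ (0 ,_) (∈-upTo⁺ j+1<p))) (refl , ≤-refl)

hookLength>1-below : ∀ {p q j} qs → j < q → hookLength (p ∷ q ∷ qs) (0 , j) ≢ 1
hookLength>1-below {p} {q} {j} qs j<q eq = <-irrefl (sym eq)
  (+-monoˡ-≤ 1 (≤-trans (∈⇒0<length box∈) (m≤n+m _ _)))
  where
  box∈ : (1 , j) ∈ boxesBelow (p ∷ q ∷ qs) (0 , j)
  box∈ = ∈-filter⁺ (below? (0 , j)) (∈-++⁺ʳ (map (0 ,_) (upTo p)) (∈-map⁺ (map₁ suc)
    (∈-++⁺ˡ (∈-map⁺ (0 ,_) (∈-upTo⁺ j<q))))) (refl , s≤s z≤n)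

youngDiagram-columns : ∀ {m} ps → All (_≤ m) ps → All (λ x → proj₂ x < m) (youngDiagram ps)
youngDiagram-columns []       []          = []
youngDiagram-columns (p ∷ ps) (p≤m ∷ ps≤m) = All.++⁺
  (All.map⁺ (All.map (λ j<p → <-≤-trans j<p p≤m) (All.all-upTo p)))
  (All.map⁺ (youngDiagram-columns ps ps≤m))

-- The row has length `suc p`, so column `p` is its last; all later rows are strictly shorter and
-- stop before that column.
hookLength-corner : ∀ {p ps} → All (_≤ p) ps → hookLength (suc p ∷ ps) (0 , p) ≡ 1
hookLength-corner {p} {ps} ps≤p = cong (_+ 1) (cong₂ _+_ right below)
  where
  row : List Box
  row = map (0 ,_) (upTo (suc p))
  right : length (boxesRight (suc p ∷ ps) (0 , p)) ≡ 0
  right = cong length (filter-none (right? (0 , p)) (All.++⁺ {xs = row}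
    (All.map⁺ {f = 0 ,_} (All.map (λ j≤p (_ , p<j) → <-irrefl refl (≤-trans (s≤s p<j) j≤p)) (All.all-upTo (suc p))))
    (All.map⁺ {f = map₁ suc} (All.universal (λ { _ (() , _) }) (youngDiagram ps)))))
  below : length (boxesBelow (suc p ∷ ps) (0 , p)) ≡ 0
  below = cong length (filter-none (below? (0 , p)) (All.++⁺ {xs = row}
    (All.map⁺ {f = 0 ,_} (All.universal (λ { _ (_ , ()) }) (upTo (suc p))))
    (All.map⁺ {f = map₁ suc} (All.map (λ { j<p (refl , _) → <-irrefl refl j<p }) (youngDiagram-columns ps ps≤p)))))

corner? : (λs : List ℕ) → Decidable (λ j → hookLength λs (0 , j) ≡ 1)
corner? λs j = hook1? λs (0 , j)

hookCount-∷ : ∀ p ps → hookCount 1 (p ∷ ps) ≡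
              length (filter (corner? (p ∷ ps)) (upTo p)) + hookCount 1 ps
hookCount-∷ p ps = trans
  (length-filter-++-map (hook1? (p ∷ ps)) (map (0 ,_) (upTo p)) (map₁ suc) (youngDiagram ps))
  (cong₂ _+_
    (length-filter-map (hook1? (p ∷ ps)) (0 ,_) (upTo p))
    (cong length (filter-≐ (hook1? (p ∷ ps) ∘ map₁ suc) (hook1? ps)
      ((λ {x} → trans (sym (hookLength-suc p ps (proj₁ x) (proj₂ x)))) ,
       (λ {x} → trans (hookLength-suc p ps (proj₁ x) (proj₂ x)))) (youngDiagram ps))))

-- Whether `P p` holds stays open, since the last box of a row may or may not be a corner.
count-last : ∀ {P : ℕ → Set} (P? : Decidable P) p → (∀ {j} → j < p → ¬ P j) →
             length (filter P? (upTo (suc p))) ≡ length (filter P? (p ∷ []))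
count-last P? p none = begin
  length (filter P? (upTo (suc p)))
    ≡⟨ cong (length ∘ filter P?) (upTo-∷ʳ p) ⟨
  length (filter P? (upTo p ∷ʳ p))
    ≡⟨ cong length (filter-++ P? (upTo p) (p ∷ [])) ⟩
  length (filter P? (upTo p) ++ filter P? (p ∷ []))
    ≡⟨ cong (λ xs → length (xs ++ filter P? (p ∷ []))) (filter-none P? (All.map none (All.all-upTo p))) ⟩
  length (filter P? (p ∷ [])) ∎
  where open ≡-Reasoning

-- In the first row every box but the last has a right neighbour, and the last has hook length 1
-- exactly when the next row is strictly shorter, which is when `newPart` is 1.
hookCount≡distinctParts : ∀ {λs} → Linked _≥_ λs → All (0 <_) λs → hookCount 1 λs ≡ distinctParts λs
hookCount≡distinctParts {[]} lnk pos = refl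
hookCount≡distinctParts {suc p ∷ ps} lnk (_ ∷ pos) = begin
  hookCount 1 (suc p ∷ ps)
    ≡⟨ hookCount-∷ (suc p) ps ⟩
  length (filter (corner? (suc p ∷ ps)) (upTo (suc p))) + hookCount 1 ps
    ≡⟨ cong₂ _+_ (trans (count-last (corner? (suc p ∷ ps)) p λ j<p → hookLength>1-right ps (s≤s j<p)) (corner ps lnk))
                 (hookCount≡distinctParts (Linked.tail lnk) pos) ⟩
  distinctParts (suc p ∷ ps) ∎
  where
  open ≡-Reasoning
  corner : ∀ qs → Linked _≥_ (suc p ∷ qs) →
           length (filter (corner? (suc p ∷ qs)) (p ∷ [])) ≡ newPart (suc p) qs
  corner [] _ = cong length (filter-accept (corner? (suc p ∷ [])) {xs = []} (hookLength-corner {p} []))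
  -- This is the comparison made inside `newPart`, so deciding it also evaluates the right-hand
  -- side.
  corner (q ∷ qs) lnk′@(q≤1+p ∷ lnk″) with suc p ≟ q
  ... | yes refl = cong length (filter-reject (corner? (suc p ∷ q ∷ qs)) {xs = []} (hookLength>1-below {suc p} {suc p} qs ≤-refl))
  ... | no p≢q   = cong length (filter-accept (corner? (suc p ∷ q ∷ qs)) {xs = []}
          (hookLength-corner (head-bound lnk″ (s≤s⁻¹ (≤∧≢⇒< q≤1+p (p≢q ∘ sym))))))

-- Closed form of the coefficients and their comparison

b-1 : ∀ s n → b (suc s) 1 n ≡
      (q^ 1 · geo s 1 (geo (suc n * suc s) 1 (geoProduct (suc s) (suc ∘ suc) n one))) n
b-1 s n = begin
  sum (map (hookCount 1) (regularPartitions t n))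
    ≡⟨ sum-↭ (Permutation.map⁺ (hookCount 1)
         (regularPartitions↭enumerate t {c} {N} (m≤n⇒m≤1+n ≤-refl) (≤-trans (n≤1+n n) (m≤m*n (suc n) t)))) ⟩
  sum (map (hookCount 1) (enumerate t c N n))
    ≡⟨ cong sum (map-cong-local (All.tabulate λ λs∈ → hookCount-sound (enumerate-sound t c N λs∈))) ⟩
  total distinctParts (enumerate t c N n)
    ≡⟨ distinctParts-enumerate t (suc n) N (n≤1+n n) ⟩
  regularSum t N (regularProduct t c N one) n
    ≡⟨ regularSum-regularProduct s (suc n) n one (n≤1+n n) ≤-refl ⟩
  (q^ 1 · geo s 1 (geo N 1 (geoProduct t (suc ∘ suc) n one))) n ∎
  where
  open ≡-Reasoning
  t = suc s
  -- `N` must be a multiple of `t` that is at least `n`. Taking `suc n` blocks leaves a factor for i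
  -- = 1 to split off, and `glaisher` then asks for the multiplicity bound `2 + n`.
  c = 2 + n
  N = suc n * t
  hookCount-sound : ∀ {λs} → RegularPartitionUpTo t N n λs → hookCount 1 λs ≡ distinctParts λs
  hookCount-sound ((isPart , _) , _) = hookCount≡distinctParts (nonincreasing isPart) (positive isPart)

theorem1p1 : (t : ℕ) → t ≥ 2 → (n : ℕ) → b (t + 1) 1 n ≥ b t 1 n
theorem1p1 (suc s) _ n rewrite +-comm s 1 = begin
  b (suc s) 1 n
    ≡⟨ b-1 s n ⟩
  (q^ 1 · geo s 1 (geo (suc n * suc s) 1 (geoProduct (suc s) (suc ∘ suc) n one))) n
    -- `s` or `t` enters in three places: the numerator, the truncation length of 1 / (1 - q), and
    -- the factors for i ≥ 2. Increasing any of them only adds nonnegative terms.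
    ≤⟨ q^-mono 1 (geo-mono 1 (n≤1+n s) (geo-mono 1 (*-monoʳ-≤ (suc n) (n≤1+n (suc s)))
         (geoProduct-mono (suc ∘ suc) n (n≤1+n (suc s)) one))) n ⟩
  (q^ 1 · geo (suc s) 1 (geo (suc n * suc (suc s)) 1 (geoProduct (suc (suc s)) (suc ∘ suc) n one))) n
    ≡⟨ b-1 (suc s) n ⟨
  b (suc (suc s)) 1 n ∎
  where open ≤-Reasoning
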